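{- Let $\mathcal{I}$ be an instance of the Square Strip Packing Problem, consider the bottom-left packing for an ordering attaining $h_{\text{BL}}^{\text{worst}}(\mathcal{I})$, let $h_{\text{BL}}$ be its height, and let $g\ge 0$ be a constant and $f$ the number such that the unoccupied space of this packing within the substrip $[0,W]\times[0,h_{\text{BL}}-g\,h_{\text{max}}]$ can be covered by $f$ copies of the squares of the instance (a union of translates in which each square of $\mathcal{I}$ is used at most $f$ times). Then $$\frac{h_{\text{BL}}^{\text{worst}}(\mathcal{I})}{h_{\text{OPT}}(\mathcal{I})}\ \le\ f+g+1 .$$
   Context: Square Strip Packing Problem: squares with side lengths at most $W$ are to be packed without rotation into the strip $[0,W]\times[0,\infty)$ with pairwise disjoint interiors; the height of a packing is the maximum top coordinate of a square, and $h_{\text{OPT}}(\mathcal{I})$ is the minimum height of a feasible packing. Bottom-left algorithm: given an ordering, place the first square at $(0,0)$ and each subsequent square at a feasible position $(x,y)$ (lower-left corner) with $(y,x)$ lexicographically minimal. $h_{\text{BL}}^{\text{worst}}(\mathcal{I})$ is the maximum over all orderings of the height of the bottom-left packing. $h_{\text{max}}$ is the largest side length of a square in $\mathcal{I}$. -}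

module Defs where

open import Algebra.Bundles using (CommutativeRing)
open import Algebra.Core using (Op₁; Op₂)
open import Algebra.Structures using (IsCommutativeRing)
import Algebra.Definitions.RawMonoid as RawMonoidDefinitions
open import Data.Fin.Base using (Fin; _<_)
open import Data.Fin.Permutation using (Permutation′; _⟨$⟩ʳ_)
open import Data.List.Base using (List; length)
open import Data.List.Relation.Unary.Any using (Any)
open import Data.Nat.Base as ℕ using (ℕ)
open import Data.Product.Base using (Σ-syntax; ∃-syntax; _×_; _,_; proj₁; proj₂; swap)
open import Data.Product.Relation.Binary.Lex.NonStrict using (×-Lex)
open import Level using (Level; _⊔_; suc)
open import Relation.Binary.Core using (Rel)
import Relation.Binary.Construct.NonStrictToStrict as NonStrictToStrict
open import Relation.Binary.Structures using (IsDecTotalOrder)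
open import Relation.Binary.PropositionalEquality.Core using (_≢_)
open import Relation.Nullary.Negation.Core using (¬_)
open import Relation.Unary using (Pred; _⊆_; _⊥_; _∈_; _∖_; ⋃)

-- The library has no real numbers.  Lengths and coordinates are taken in an
-- arbitrary ordered field; the real numbers, with their classical
-- (decidable) order, are one.

record OrderedField (c ℓ₁ ℓ₂ : Level) : Set (suc (c ⊔ ℓ₁ ⊔ ℓ₂)) where
  infix  8 _⁻¹
  infix  8 -_
  infixl 7 _*_ _/_
  infixl 6 _+_ _-_
  infix  4 _≈_ _≤_
  field
    Carrier           : Set c
    _≈_               : Rel Carrier ℓ₁
    _≤_               : Rel Carrier ℓ₂
    _+_ _*_           : Op₂ Carrier
    -_ _⁻¹            : Op₁ Carrier
    0# 1#             : Carrier
    isCommutativeRing : IsCommutativeRing _≈_ _+_ _*_ -_ 0# 1#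
    isDecTotalOrder   : IsDecTotalOrder _≈_ _≤_
    0≉1               : ¬ (0# ≈ 1#)
    -- The inverse is total; nothing is assumed about the value of 0# ⁻¹.
    ⁻¹-cong           : ∀ {x y} → x ≈ y → x ⁻¹ ≈ y ⁻¹
    ⁻¹-inverseʳ       : ∀ x → ¬ (x ≈ 0#) → x * x ⁻¹ ≈ 1#
    +-monoʳ-≤         : ∀ x {y z} → y ≤ z → x + y ≤ x + z
    *-nonNeg          : ∀ {x y} → 0# ≤ x → 0# ≤ y → 0# ≤ x * y

  commutativeRing : CommutativeRing c ℓ₁
  commutativeRing = record { isCommutativeRing = isCommutativeRing }

  open RawMonoidDefinitions (CommutativeRing.+-rawMonoid commutativeRing)
    using () renaming (_×_ to _·_)

  open NonStrictToStrict _≈_ _≤_ public using () renaming (_<_ to infix 4 _≺_)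

  _-_ : Op₂ Carrier
  x - y = x + (- y)

  _/_ : Op₂ Carrier
  x / y = x * y ⁻¹

  fromℕ : ℕ → Carrier
  fromℕ n = n · 1#

module SquarePacking {c ℓ₁ ℓ₂ : Level} (F : OrderedField c ℓ₁ ℓ₂) where

  open OrderedField F

  IsMaximum : ∀ {ℓ} → Pred Carrier ℓ → Carrier → Set (c ⊔ ℓ₂ ⊔ ℓ)
  IsMaximum P m = m ∈ P × (∀ x → x ∈ P → x ≤ m)

  IsMinimum : ∀ {ℓ} → Pred Carrier ℓ → Carrier → Set (c ⊔ ℓ₂ ⊔ ℓ)
  IsMinimum P m = m ∈ P × (∀ x → x ∈ P → m ≤ x)

  Point : Set c
  Point = Carrier × Carrier

  -- Squares are given by their lower-left corner and side length.

  Square : Point → Carrier → Pred Point ℓ₂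
  Square (x , y) s (u , v) = (x ≤ u × u ≤ x + s) × (y ≤ v × v ≤ y + s)

  Interior : Point → Carrier → Pred Point (ℓ₁ ⊔ ℓ₂)
  Interior (x , y) s (u , v) = (x ≺ u × u ≺ x + s) × (y ≺ v × v ≺ y + s)

  Strip : Carrier → Pred Point ℓ₂
  Strip W (u , v) = (0# ≤ u × u ≤ W) × 0# ≤ v

  Substrip : Carrier → Carrier → Pred Point ℓ₂
  Substrip W h (u , v) = (0# ≤ u × u ≤ W) × (0# ≤ v × v ≤ h)

  -- (y , x) is lexicographically at most (y′ , x′).

  _≤ₗₑₓ_ : Rel Point (ℓ₁ ⊔ ℓ₂)
  p ≤ₗₑₓ q = ×-Lex _≈_ _≤_ _≤_ (swap p) (swap q)

  record Instance (n : ℕ) : Set (c ⊔ ℓ₁ ⊔ ℓ₂) where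
    field
      W      : Carrier
      side   : Fin n → Carrier
      side>0 : ∀ i → 0# ≺ side i
      side≤W : ∀ i → side i ≤ W

  module _ {n : ℕ} (I : Instance n) where

    open Instance I

    Placement : Set c
    Placement = Fin n → Point

    IsPacking : Placement → Set (c ⊔ ℓ₁ ⊔ ℓ₂)
    IsPacking pos =
        (∀ i → Square (pos i) (side i) ⊆ Strip W)
      × (∀ i j → i ≢ j → Interior (pos i) (side i) ⊥ Interior (pos j) (side j))

    IsHeight : Placement → Carrier → Set (c ⊔ ℓ₁ ⊔ ℓ₂)
    IsHeight pos = IsMaximum (λ t → ∃[ i ] t ≈ proj₂ (pos i) + side i)

    IsOptimalHeight : Carrier → Set (c ⊔ ℓ₁ ⊔ ℓ₂)
    IsOptimalHeight = IsMinimum (λ h → ∃[ pos ] (IsPacking pos × IsHeight pos h))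

    IsLargestSide : Carrier → Set (c ⊔ ℓ₁ ⊔ ℓ₂)
    IsLargestSide = IsMaximum (λ s → ∃[ i ] s ≈ side i)

    -- An ordering σ lists the squares as σ 0, σ 1, …; FeasibleAt σ pos k is the
    -- set of positions available to the square σ k once σ 0, …, σ (k-1) have
    -- been placed.

    FeasibleAt : Permutation′ n → Placement → Fin n → Pred Point (c ⊔ ℓ₁ ⊔ ℓ₂)
    FeasibleAt σ pos k p =
        Square p (side (σ ⟨$⟩ʳ k)) ⊆ Strip W
      × (∀ j → j < k →
           Interior (pos (σ ⟨$⟩ʳ j)) (side (σ ⟨$⟩ʳ j)) ⊥ Interior p (side (σ ⟨$⟩ʳ k)))

    -- For the first square the minimal feasible position is the origin, because
    -- side lengths are at most W.

    IsBottomLeft : Permutation′ n → Placement → Set (c ⊔ ℓ₁ ⊔ ℓ₂)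
    IsBottomLeft σ pos = ∀ k →
        pos (σ ⟨$⟩ʳ k) ∈ FeasibleAt σ pos k
      × (∀ q → q ∈ FeasibleAt σ pos k → pos (σ ⟨$⟩ʳ k) ≤ₗₑₓ q)

    IsWorstBottomLeftHeight : Carrier → Set (c ⊔ ℓ₁ ⊔ ℓ₂)
    IsWorstBottomLeftHeight =
      IsMaximum (λ h → ∃[ σ ] ∃[ pos ] (IsBottomLeft σ pos × IsHeight pos h))

    Occupied : Placement → Pred Point ℓ₂
    Occupied pos = ⋃ (Fin n) (λ i → Square (pos i) (side i))

    Unoccupied : Placement → Carrier → Pred Point ℓ₂
    Unoccupied pos h = Substrip W h ∖ Occupied pos

    -- copies i lists the positions of the translates of square i; the copies may
    -- overlap one another and may reach outside S.

    CoverableBy : ∀ {ℓ} → ℕ → Pred Point ℓ → Set (c ⊔ ℓ₂ ⊔ ℓ)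
    CoverableBy f S = Σ[ copies ∈ (Fin n → List Point) ]
        (∀ i → length (copies i) ℕ.≤ f)
      × S ⊆ ⋃ (Fin n) (λ i q → Any (λ p → q ∈ Square p (side i)) (copies i))

{-# OPTIONS --safe #-}
module Submission where

-- An area argument.  With H = hBL − g hMax, the packed squares and the f copies
-- cover the substrip of height H, so W H ≤ (f + 1) ∑ sᵢ², while an optimal packing
-- gives ∑ sᵢ² ≤ W hOPT.  Hence H ≤ (f + 1) hOPT, and hMax ≤ hOPT bounds the rest.
-- Both area inequalities hold over any ordered field because a step function
-- ∑ wᵢ 1[aᵢ,bᵢ) that is everywhere nonnegative has ∑ wᵢ (bᵢ − aᵢ) ≥ 0; applying
-- this once per coordinate compares the areas of two lists of boxes.

open import Defs
open import Data.Fin.Permutation using (Permutation′)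
open import Data.Nat.Base using (ℕ)
open import Algebra.Bundles using (CommutativeRing)
import Algebra.Properties.CommutativeSemigroup as CommutativeSemigroupProperties
import Algebra.Properties.Ring as RingProperties
open import Data.Bool.Base using (if_then_else_)
open import Data.Fin.Base using (Fin)
open import Data.Fin.Properties using (any?)
open import Data.List.Base using (List; []; _∷_; _++_; map; concatMap; allFin; length)
import Data.List.Extrema as Extrema
open import Data.List.Membership.Propositional.Properties using (∈-allFin)
open import Data.List.Relation.Unary.All as All using (All; []; _∷_)
import Data.List.Relation.Unary.All.Properties as All
open import Data.List.Relation.Unary.AllPairs using (AllPairs; []; _∷_)
import Data.List.Relation.Unary.AllPairs.Properties as AllPairs
open import Data.List.Relation.Unary.Any as Any using (Any; here; there)
import Data.List.Relation.Unary.Any.Properties as Any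
import Data.Nat.Base as ℕ
open import Data.Product.Base using (∃-syntax; _×_; _,_; proj₁; proj₂)
open import Data.Sum.Base using (_⊎_; inj₁; inj₂)
open import Function.Base using (_∘_)
open import Level using (_⊔_)
open import Relation.Binary.Bundles using (DecTotalOrder)
import Relation.Binary.Properties.TotalOrder as TotalOrderProperties
open import Relation.Binary.PropositionalEquality.Core as ≡ using (_≢_)
import Relation.Binary.Reasoning.PartialOrder as PartialOrderReasoning
open import Relation.Nullary.Decidable using (Dec; yes; no; does; _×-dec_; ¬?)
open import Relation.Nullary.Negation using (¬_; contradiction)

-- Arithmetic and order in an ordered field.

module OrderedFieldProperties {c ℓ₁ ℓ₂} (F : OrderedField c ℓ₁ ℓ₂) where

  open OrderedField F public

  decTotalOrder : DecTotalOrder c ℓ₁ ℓ₂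
  decTotalOrder = record { isDecTotalOrder = isDecTotalOrder }

  open DecTotalOrder decTotalOrder public
    using (total; antisym; reflexive; _≤?_; totalOrder; poset)
    renaming (refl to ≤-refl; trans to ≤-trans)
  open TotalOrderProperties totalOrder public
    using (<⇒≱; ≰⇒>; ≰⇒≥)
  open CommutativeRing commutativeRing public
    using ( refl; sym; trans; ring; +-cong; +-congˡ; +-congʳ; *-cong; *-congˡ; *-congʳ
          ; -‿cong; +-assoc; +-comm; +-identityˡ; +-identityʳ; -‿inverseʳ
          ; *-assoc; *-comm; *-identityˡ; *-identityʳ; distribˡ; distribʳ; zeroˡ; zeroʳ
          ; +-commutativeSemigroup; *-commutativeSemigroup)
  open RingProperties ring public
    using (-‿distribʳ-*; -1*x≈-x; x[y-z]≈xy-xz; xyx⁻¹≈y; -‿involutive)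
  open CommutativeSemigroupProperties +-commutativeSemigroup public
    using () renaming (interchange to +-interchange)
  open CommutativeSemigroupProperties *-commutativeSemigroup public
    using () renaming (xy∙z≈xz∙y to *-xy∙z≈xz∙y)
  open PartialOrderReasoning poset public

  +-mono-≤ : ∀ {x y u v} → x ≤ y → u ≤ v → x + u ≤ y + v
  +-mono-≤ {x} {y} {u} {v} x≤y u≤v = begin
    x + u  ≤⟨ +-monoʳ-≤ x u≤v ⟩
    x + v  ≈⟨ +-comm x v ⟩
    v + x  ≤⟨ +-monoʳ-≤ v x≤y ⟩
    v + y  ≈⟨ +-comm v y ⟩
    y + v  ∎

  +-nonNeg : ∀ {x y} → 0# ≤ x → 0# ≤ y → 0# ≤ x + y
  +-nonNeg 0≤x 0≤y = ≤-trans (reflexive (sym (+-identityˡ 0#))) (+-mono-≤ 0≤x 0≤y)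

  x+[y-x]≈y : ∀ x y → x + (y - x) ≈ y
  x+[y-x]≈y x y = trans (sym (+-assoc x y (- x))) (xyx⁻¹≈y x y)

  [y-x]+x≈y : ∀ x y → (y - x) + x ≈ y
  [y-x]+x≈y x y = trans (+-comm (y - x) x) (x+[y-x]≈y x y)

  x≤y⇒0≤y-x : ∀ {x y} → x ≤ y → 0# ≤ y - x
  x≤y⇒0≤y-x {x} {y} x≤y = begin
    0#     ≈⟨ -‿inverseʳ x ⟨
    x - x  ≤⟨ +-mono-≤ x≤y ≤-refl ⟩
    y - x  ∎

  0≤y-x⇒x≤y : ∀ {x y} → 0# ≤ y - x → x ≤ y
  0≤y-x⇒x≤y {x} {y} 0≤y-x = begin
    x            ≈⟨ +-identityʳ x ⟨
    x + 0#       ≤⟨ +-monoʳ-≤ x 0≤y-x ⟩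
    x + (y - x)  ≈⟨ x+[y-x]≈y x y ⟩
    y            ∎

  +-cancelˡ-nonNeg : ∀ {x y} → x ≤ x + y → 0# ≤ y
  +-cancelˡ-nonNeg {x} {y} x≤x+y = begin
    0#           ≤⟨ x≤y⇒0≤y-x x≤x+y ⟩
    x + y - x    ≈⟨ xyx⁻¹≈y x y ⟩
    y            ∎

  x-y≤z⇒x≤z+y : ∀ {x y z} → x - y ≤ z → x ≤ z + y
  x-y≤z⇒x≤z+y {x} {y} {z} x-y≤z = begin
    x          ≈⟨ [y-x]+x≈y y x ⟨
    x - y + y  ≤⟨ +-mono-≤ x-y≤z ≤-refl ⟩
    z + y      ∎

  *-monoˡ-≤ : ∀ {k x y} → 0# ≤ k → x ≤ y → k * x ≤ k * y
  *-monoˡ-≤ {k} {x} {y} 0≤k x≤y = 0≤y-x⇒x≤y (begin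
    0#             ≤⟨ *-nonNeg 0≤k (x≤y⇒0≤y-x x≤y) ⟩
    k * (y - x)    ≈⟨ x[y-z]≈xy-xz k y x ⟩
    k * y - k * x  ∎)

  *-monoʳ-≤ : ∀ {k x y} → 0# ≤ k → x ≤ y → x * k ≤ y * k
  *-monoʳ-≤ {k} {x} {y} 0≤k x≤y = begin
    x * k  ≈⟨ *-comm x k ⟩
    k * x  ≤⟨ *-monoˡ-≤ 0≤k x≤y ⟩
    k * y  ≈⟨ *-comm k y ⟩
    y * k  ∎

  x≤0⇒0≤-x : ∀ {x} → x ≤ 0# → 0# ≤ - x
  x≤0⇒0≤-x {x} x≤0 = ≤-trans (x≤y⇒0≤y-x x≤0) (reflexive (+-identityˡ (- x)))

  -- Otherwise `- 1#` would be nonnegative, and so would its square, which is `1#`.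
  0≤1 : 0# ≤ 1#
  0≤1 with total 0# 1#
  ... | inj₁ 0≤1 = 0≤1
  ... | inj₂ 1≤0 = begin
    0#             ≤⟨ *-nonNeg 0≤-1 0≤-1 ⟩
    - 1# * - 1#    ≈⟨ -1*x≈-x (- 1#) ⟩
    - - 1#         ≈⟨ -‿involutive 1# ⟩
    1#             ∎
    where
    0≤-1 : 0# ≤ - 1#
    0≤-1 = x≤0⇒0≤-x 1≤0

  1≰0 : ¬ (1# ≤ 0#)
  1≰0 1≤0 = 0≉1 (antisym 0≤1 1≤0)

  ⁻¹-inverse : ∀ {x} → 0# ≺ x → x * x ⁻¹ ≈ 1#
  ⁻¹-inverse {x} (_ , 0≉x) = ⁻¹-inverseʳ x (0≉x ∘ sym)

  -- If `x ⁻¹ ≤ 0#`, the product of the nonnegative elements `x` and `- (x ⁻¹)` is `- 1#`, which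
  -- forces `1# ≤ 0#`.
  ⁻¹-nonNeg : ∀ {x} → 0# ≺ x → 0# ≤ x ⁻¹
  ⁻¹-nonNeg {x} 0<x with total 0# (x ⁻¹)
  ... | inj₁ 0≤x⁻¹ = 0≤x⁻¹
  ... | inj₂ x⁻¹≤0 = contradiction 1≤0 1≰0
    where
    1≤0 : 1# ≤ 0#
    1≤0 = 0≤y-x⇒x≤y (begin
      0#              ≤⟨ *-nonNeg (proj₁ 0<x) (x≤0⇒0≤-x x⁻¹≤0) ⟩
      x * - (x ⁻¹)    ≈⟨ -‿distribʳ-* x (x ⁻¹) ⟨
      - (x * x ⁻¹)    ≈⟨ -‿cong (⁻¹-inverse 0<x) ⟩
      - 1#            ≈⟨ +-identityˡ (- 1#) ⟨
      0# - 1#         ∎)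

  [xk]/k≈x : ∀ {k} x → 0# ≺ k → (x * k) / k ≈ x
  [xk]/k≈x {k} x 0<k = begin-equality
    (x * k) * k ⁻¹  ≈⟨ *-assoc x k (k ⁻¹) ⟩
    x * (k * k ⁻¹)  ≈⟨ *-congˡ (⁻¹-inverse 0<k) ⟩
    x * 1#          ≈⟨ *-identityʳ x ⟩
    x               ∎

  x≤yk⇒x/k≤y : ∀ {k x y} → 0# ≺ k → x ≤ y * k → x / k ≤ y
  x≤yk⇒x/k≤y {k} {x} {y} 0<k x≤yk =
    ≤-trans (*-monoʳ-≤ (⁻¹-nonNeg 0<k) x≤yk) (reflexive ([xk]/k≈x y 0<k))

  *-cancelʳ-≤ : ∀ {k x y} → 0# ≺ k → x * k ≤ y * k → x ≤ y
  *-cancelʳ-≤ {x = x} 0<k xk≤yk =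
    ≤-trans (reflexive (sym ([xk]/k≈x x 0<k))) (x≤yk⇒x/k≤y 0<k xk≤yk)

  <-≤-trans : ∀ {x y z} → x ≺ y → y ≤ z → x ≺ z
  <-≤-trans {x} {y} {z} x<y y≤z = begin-strict
    x  <⟨ x<y ⟩
    y  ≤⟨ y≤z ⟩
    z  ∎

  ≤-<-trans : ∀ {x y z} → x ≤ y → y ≺ z → x ≺ z
  ≤-<-trans {x} {y} {z} x≤y y<z = begin-strict
    x  ≤⟨ x≤y ⟩
    y  <⟨ y<z ⟩
    z  ∎

  +-monoʳ-< : ∀ x {y z} → y ≺ z → x + y ≺ x + z
  +-monoʳ-< x {y} {z} (y≤z , y≉z) = +-monoʳ-≤ x y≤z , λ x+y≈x+z → y≉z (begin-equality
    y            ≈⟨ xyx⁻¹≈y x y ⟨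
    x + y - x    ≈⟨ +-congʳ x+y≈x+z ⟩
    x + z - x    ≈⟨ xyx⁻¹≈y x z ⟩
    z            ∎)

  x<x+1 : ∀ x → x ≺ x + 1#
  x<x+1 x = begin-strict
    x       ≈⟨ +-identityʳ x ⟨
    x + 0#  <⟨ +-monoʳ-< x (0≤1 , 0≉1) ⟩
    x + 1#  ∎

  -- Midpoints and small shifts to the right.

  midpoint : Carrier → Carrier → Carrier
  midpoint x y = (x + y) / (1# + 1#)

  midpoint+midpoint : ∀ x y → midpoint x y + midpoint x y ≈ x + y
  midpoint+midpoint x y = begin-equality
    (x + y) * ½ + (x + y) * ½  ≈⟨ distribˡ (x + y) ½ ½ ⟨
    (x + y) * (½ + ½)          ≈⟨ *-congˡ ½+½≈1 ⟩
    (x + y) * 1#               ≈⟨ *-identityʳ (x + y) ⟩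
    x + y                      ∎
    where
    ½ : Carrier
    ½ = (1# + 1#) ⁻¹

    0<2 : 0# ≺ 1# + 1#
    0<2 = begin-strict
      0#       ≤⟨ 0≤1 ⟩
      1#       <⟨ x<x+1 1# ⟩
      1# + 1#  ∎

    ½+½≈1 : ½ + ½ ≈ 1#
    ½+½≈1 = begin-equality
      ½ + ½              ≈⟨ +-cong (*-identityˡ ½) (*-identityˡ ½) ⟨
      1# * ½ + 1# * ½    ≈⟨ distribʳ ½ 1# 1# ⟨
      (1# + 1#) * ½      ≈⟨ ⁻¹-inverse 0<2 ⟩
      1#                 ∎

  x<midpoint : ∀ {x y} → x ≺ y → x ≺ midpoint x y
  x<midpoint {x} {y} x<y = ≰⇒> λ m≤x → <⇒≱ (+-monoʳ-< x x<y) (begin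
    x + y                            ≈⟨ midpoint+midpoint x y ⟨
    midpoint x y + midpoint x y      ≤⟨ +-mono-≤ m≤x m≤x ⟩
    x + x                            ∎)

  midpoint<y : ∀ {x y} → x ≺ y → midpoint x y ≺ y
  midpoint<y {x} {y} x<y = ≰⇒> λ y≤m → <⇒≱ (+-monoʳ-< y x<y) (begin
    y + y                            ≤⟨ +-mono-≤ y≤m y≤m ⟩
    midpoint x y + midpoint x y      ≈⟨ midpoint+midpoint x y ⟩
    x + y                            ≈⟨ +-comm x y ⟩
    y + x                            ∎)

  -- A strict shift of `x` that crosses none of the finitely many thresholds `ps`. It serves to pass
  -- between half-open membership at `x` and closed or open membership at `x′`.
  right-neighbour : ∀ x ps → ∃[ x′ ] (x ≺ x′ × All (λ p → p ≤ x′ → p ≤ x) ps)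
  right-neighbour x [] = x + 1# , x<x+1 x , []
  right-neighbour x (p ∷ ps) with right-neighbour x ps | p ≤? x
  ... | x′ , x<x′ , free | yes p≤x = x′ , x<x′ , (λ _ → p≤x) ∷ free
  ... | x′ , x<x′ , free | no p≰x with p ≤? x′
  ...   | no p≰x′  = x′ , x<x′ , (λ p≤x′ → contradiction p≤x′ p≰x′) ∷ free
  -- Here `p` lies in the gap between `x` and `x′`, so the shift is shortened to stop before `p`.
  -- The thresholds treated earlier stay uncrossed because the new point is below `x′`.
  ...   | yes p≤x′ = midpoint x p , x<midpoint x<p
                   , (λ p≤m → contradiction p≤m (<⇒≱ m<p))
                   ∷ All.map (λ free-q q≤m → free-q (≤-trans q≤m (≤-trans (proj₁ m<p) p≤x′))) free
    where
    x<p : x ≺ p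
    x<p = ≰⇒> p≰x

    m<p : midpoint x p ≺ p
    m<p = midpoint<y x<p

  -- Natural multiples and finite sums.

  0≤fromℕ : ∀ m → 0# ≤ fromℕ m
  0≤fromℕ ℕ.zero    = ≤-refl
  0≤fromℕ (ℕ.suc m) = +-nonNeg 0≤1 (0≤fromℕ m)

  ∑ : ∀ {a} {A : Set a} → List A → (A → Carrier) → Carrier
  ∑ []       f = 0#
  ∑ (x ∷ xs) f = f x + ∑ xs f

  module _ {a} {A : Set a} where

    ∑-cong-All : ∀ {xs : List A} {f g} → All (λ x → f x ≈ g x) xs → ∑ xs f ≈ ∑ xs g
    ∑-cong-All []        = refl
    ∑-cong-All (eq ∷ eqs) = +-cong eq (∑-cong-All eqs)

    ∑-cong : ∀ (xs : List A) {f g} → (∀ x → f x ≈ g x) → ∑ xs f ≈ ∑ xs g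
    ∑-cong xs eq = ∑-cong-All (All.universal eq xs)

    ∑-mono : ∀ (xs : List A) {f g} → (∀ x → f x ≤ g x) → ∑ xs f ≤ ∑ xs g
    ∑-mono []       le = ≤-refl
    ∑-mono (x ∷ xs) le = +-mono-≤ (le x) (∑-mono xs le)

    ∑-nonNeg : ∀ (xs : List A) {f} → (∀ x → 0# ≤ f x) → 0# ≤ ∑ xs f
    ∑-nonNeg []       le = ≤-refl
    ∑-nonNeg (x ∷ xs) le = +-nonNeg (le x) (∑-nonNeg xs le)

    ∑-zero : ∀ {xs : List A} {f} → All (λ x → f x ≈ 0#) xs → ∑ xs f ≈ 0#
    ∑-zero []         = refl
    ∑-zero (eq ∷ eqs) = trans (+-cong eq (∑-zero eqs)) (+-identityˡ 0#)

    ∑-distrib-+ : ∀ (xs : List A) f g → ∑ xs (λ x → f x + g x) ≈ ∑ xs f + ∑ xs g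
    ∑-distrib-+ []       f g = sym (+-identityˡ 0#)
    ∑-distrib-+ (x ∷ xs) f g = trans (+-congˡ (∑-distrib-+ xs f g))
      (+-interchange (f x) (g x) (∑ xs f) (∑ xs g))

    *-distribʳ-∑ : ∀ (xs : List A) f k → ∑ xs (λ x → f x * k) ≈ ∑ xs f * k
    *-distribʳ-∑ []       f k = sym (zeroˡ k)
    *-distribʳ-∑ (x ∷ xs) f k = trans (+-congˡ (*-distribʳ-∑ xs f k)) (sym (distribʳ k (f x) (∑ xs f)))

    ∑-++ : ∀ (xs ys : List A) f → ∑ (xs ++ ys) f ≈ ∑ xs f + ∑ ys f
    ∑-++ []       ys f = sym (+-identityˡ (∑ ys f))
    ∑-++ (x ∷ xs) ys f = trans (+-congˡ (∑-++ xs ys f)) (sym (+-assoc (f x) (∑ xs f) (∑ ys f)))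

    -- Each term uses up one of the `m` summands `k`; the summands left over when the list is
    -- shorter than `m` are nonnegative.
    ∑-≤-length : ∀ (xs : List A) {f k m} → length xs ℕ.≤ m → 0# ≤ k → (∀ x → f x ≤ k) →
                 ∑ xs f ≤ fromℕ m * k
    ∑-≤-length []       {m = m} _ 0≤k f≤k = *-nonNeg (0≤fromℕ m) 0≤k
    ∑-≤-length (x ∷ xs) {f} {k} {ℕ.suc m} (ℕ.s≤s len) 0≤k f≤k = begin
      f x + ∑ xs f         ≤⟨ +-mono-≤ (f≤k x) (∑-≤-length xs len 0≤k f≤k) ⟩
      k + fromℕ m * k      ≈⟨ +-congʳ (*-identityˡ k) ⟨
      1# * k + fromℕ m * k ≈⟨ distribʳ k 1# (fromℕ m) ⟨
      (1# + fromℕ m) * k   ∎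

    -- The term at which `P` holds contributes `1#`, and all other terms are nonnegative.
    ∑-≥1 : ∀ {p} {P : A → Set p} {xs : List A} {f} →
           (∀ x → 0# ≤ f x) → (∀ {x} → P x → f x ≈ 1#) → Any P xs → 1# ≤ ∑ xs f
    ∑-≥1 {xs = x ∷ xs} {f} 0≤f f≈1 (here px) = begin
      1#             ≈⟨ +-identityʳ 1# ⟨
      1# + 0#        ≤⟨ +-mono-≤ (reflexive (sym (f≈1 px))) (∑-nonNeg xs 0≤f) ⟩
      f x + ∑ xs f   ∎
    ∑-≥1 {xs = x ∷ xs} {f} 0≤f f≈1 (there pxs) = begin
      1#             ≈⟨ +-identityˡ 1# ⟨
      0# + 1#        ≤⟨ +-mono-≤ (0≤f x) (∑-≥1 0≤f f≈1 pxs) ⟩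
      f x + ∑ xs f   ∎

  module _ {a b} {A : Set a} {B : Set b} where

    ∑-map : ∀ (h : A → B) xs f → ∑ (map h xs) f ≈ ∑ xs (f ∘ h)
    ∑-map h []       f = refl
    ∑-map h (x ∷ xs) f = +-congˡ (∑-map h xs f)

    ∑-concatMap : ∀ (h : A → List B) xs f → ∑ (concatMap h xs) f ≈ ∑ xs (λ x → ∑ (h x) f)
    ∑-concatMap h []       f = refl
    ∑-concatMap h (x ∷ xs) f = trans (∑-++ (h x) (concatMap h xs) f) (+-congˡ (∑-concatMap h xs f))

-- Step functions of one variable.

module Area {c ℓ₁ ℓ₂} (F : OrderedField c ℓ₁ ℓ₂) where

  open OrderedFieldProperties F
  open Extrema totalOrder using (min; max; min≤xs; xs≤max; ⊥≤max)

  𝟙 : ∀ {p} {P : Set p} → Dec P → Carrier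
  𝟙 d = if does d then 1# else 0#

  module _ {p} {P : Set p} where

    𝟙-true : (d : Dec P) → P → 𝟙 d ≈ 1#
    𝟙-true (yes _)  _ = refl
    𝟙-true (no ¬p)  p = contradiction p ¬p

    𝟙-false : (d : Dec P) → ¬ P → 𝟙 d ≈ 0#
    𝟙-false (yes p) ¬p = contradiction p ¬p
    𝟙-false (no _)  _  = refl

  -- Half-open intervals, so that an indicator is constant between consecutive endpoints.

  _∈[_,_⟩ : Carrier → Carrier → Carrier → Set ℓ₂
  t ∈[ a , b ⟩ = a ≤ t × ¬ (b ≤ t)

  _∈?[_,_⟩ : ∀ t a b → Dec (t ∈[ a , b ⟩)
  t ∈?[ a , b ⟩ = (a ≤? t) ×-dec ¬? (b ≤? t)

  -- For `a ≤ b` this is a primitive in `t` of the indicator of the interval from `a` to `b`,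
  -- normalised to rise from `a` to `b`. It replaces integration.
  clamp : Carrier → Carrier → Carrier → Carrier
  clamp a b t = if does (t ≤? a) then a else if does (b ≤? t) then b else t

  module _ {a b t : Carrier} where

    clamp-below : t ≤ a → clamp a b t ≈ a
    clamp-below t≤a with t ≤? a
    ... | yes _   = refl
    ... | no t≰a  = contradiction t≤a t≰a

    clamp-above : a ≤ b → b ≤ t → clamp a b t ≈ b
    clamp-above a≤b b≤t with t ≤? a
    ... | yes t≤a = antisym a≤b (≤-trans b≤t t≤a)
    ... | no _ with b ≤? t
    ...   | yes _  = refl
    ...   | no b≰t = contradiction b≤t b≰t

    clamp-inside : a ≤ t → t ≤ b → clamp a b t ≈ t
    clamp-inside a≤t t≤b with t ≤? a
    ... | yes t≤a = antisym a≤t t≤a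
    ... | no _ with b ≤? t
    ...   | yes b≤t = antisym b≤t t≤b
    ...   | no _    = refl

  -- With neither endpoint strictly between `l` and `r`, the indicator keeps its value at `l` up to
  -- `r`, and that value is the slope of `clamp` there.
  clamp-step : ∀ {a b l r} → a ≤ b → l ≤ r → a ≤ l ⊎ r ≤ a → b ≤ l ⊎ r ≤ b →
               clamp a b r ≈ clamp a b l + 𝟙 (l ∈?[ a , b ⟩) * (r - l)
  clamp-step {a} {b} {l} {r} a≤b l≤r a-outside b-outside = by-cases (a ≤? l) (b ≤? l)
    where
    constant : ∀ {v} → clamp a b r ≈ v → clamp a b l ≈ v → ¬ (l ∈[ a , b ⟩) →
               clamp a b r ≈ clamp a b l + 𝟙 (l ∈?[ a , b ⟩) * (r - l)
    constant {v} at-r at-l l∉ = begin-equality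
      clamp a b r                                   ≈⟨ at-r ⟩
      v                                             ≈⟨ at-l ⟨
      clamp a b l                                   ≈⟨ +-identityʳ _ ⟨
      clamp a b l + 0#                              ≈⟨ +-congˡ (zeroˡ (r - l)) ⟨
      clamp a b l + 0# * (r - l)                    ≈⟨ +-congˡ (*-congʳ (𝟙-false (l ∈?[ a , b ⟩) l∉)) ⟨
      clamp a b l + 𝟙 (l ∈?[ a , b ⟩) * (r - l)     ∎

    r≤ : ∀ {p} → p ≤ l ⊎ r ≤ p → ¬ (p ≤ l) → r ≤ p
    r≤ (inj₁ p≤l) p≰l = contradiction p≤l p≰l
    r≤ (inj₂ r≤p) _   = r≤p

    by-cases : Dec (a ≤ l) → Dec (b ≤ l) →
               clamp a b r ≈ clamp a b l + 𝟙 (l ∈?[ a , b ⟩) * (r - l)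
    by-cases (no a≰l) _ =
      constant (clamp-below (r≤ a-outside a≰l)) (clamp-below (≰⇒≥ a≰l)) (a≰l ∘ proj₁)
    by-cases (yes _) (yes b≤l) =
      constant (clamp-above a≤b (≤-trans b≤l l≤r)) (clamp-above a≤b b≤l) (λ l∈ → proj₂ l∈ b≤l)
    by-cases (yes a≤l) (no b≰l) = begin-equality
      clamp a b r                                ≈⟨ clamp-inside (≤-trans a≤l l≤r) (r≤ b-outside b≰l) ⟩
      r                                          ≈⟨ x+[y-x]≈y l r ⟨
      l + (r - l)                                ≈⟨ +-cong (clamp-inside a≤l (≰⇒≥ b≰l)) (*-identityˡ (r - l)) ⟨
      clamp a b l + 1# * (r - l)                 ≈⟨ +-congˡ (*-congʳ (𝟙-true (l ∈?[ a , b ⟩) (a≤l , b≰l))) ⟨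
      clamp a b l + 𝟙 (l ∈?[ a , b ⟩) * (r - l)  ∎

  -- Any interval can be cut at the points of `ps`, so monotonicity only has to be checked on
  -- intervals with none of these points in their interior. The induction removes one cut point at a
  -- time.
  monotone-across : (G : Carrier → Carrier) (ps : List Carrier) →
    (∀ l r → l ≤ r → All (λ p → p ≤ l ⊎ r ≤ p) ps → G l ≤ G r) →
    ∀ l r → l ≤ r → G l ≤ G r
  monotone-across G []       step l r l≤r = step l r l≤r []
  monotone-across G (p ∷ ps) step = monotone-across G ps step′
    where
    step′ : ∀ l r → l ≤ r → All (λ q → q ≤ l ⊎ r ≤ q) ps → G l ≤ G r
    step′ l r l≤r outside with total p l | total r p
    ... | inj₁ p≤l | _        = step l r l≤r (inj₁ p≤l ∷ outside)
    ... | inj₂ _   | inj₁ r≤p = step l r l≤r (inj₂ r≤p ∷ outside)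
    -- The interval is cut at `p`, which is an endpoint of both halves; a point not interior to the
    -- whole interval is not interior to either half.
    ... | inj₂ l≤p | inj₂ p≤r = ≤-trans
      (step l p l≤p (inj₂ ≤-refl ∷ All.map narrowˡ outside))
      (step p r p≤r (inj₁ ≤-refl ∷ All.map narrowʳ outside))
      where
      narrowˡ : ∀ {q} → q ≤ l ⊎ r ≤ q → q ≤ l ⊎ p ≤ q
      narrowˡ (inj₁ q≤l) = inj₁ q≤l
      narrowˡ (inj₂ r≤q) = inj₂ (≤-trans p≤r r≤q)

      narrowʳ : ∀ {q} → q ≤ l ⊎ r ≤ q → q ≤ p ⊎ r ≤ q
      narrowʳ (inj₁ q≤l) = inj₁ (≤-trans q≤l l≤p)
      narrowʳ (inj₂ r≤q) = inj₂ r≤q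

  module _ {i} {A : Set i} where

    -- The primitive t ↦ ∑ wₓ clamp aₓ bₓ t of the step function is nondecreasing.

    length-nonNeg : (xs : List A) (w a b : A → Carrier) → (∀ x → a x ≤ b x) →
      (∀ t → 0# ≤ ∑ xs (λ x → w x * 𝟙 (t ∈?[ a x , b x ⟩))) →
      0# ≤ ∑ xs (λ x → w x * (b x - a x))
    length-nonNeg xs w a b a≤b nonNeg = +-cancelˡ-nonNeg (begin
      ∑ xs (λ x → w x * a x)                                      ≈⟨ ∑-cong-All (All.map (λ bot≤a → *-congˡ (clamp-below bot≤a)) (All.map⁻ (min≤xs 0# as))) ⟨
      G bot                                                       ≤⟨ monotone-across G (as ++ bs) step bot top (⊥≤max bot bs) ⟩
      G top                                                       ≈⟨ ∑-cong-All (All.map (λ {x} b≤top → *-congˡ (clamp-above (a≤b x) b≤top)) (All.map⁻ (xs≤max bot bs))) ⟩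
      ∑ xs (λ x → w x * b x)                                      ≈⟨ ∑-cong xs (λ x → trans (*-congˡ (sym (x+[y-x]≈y (a x) (b x)))) (distribˡ (w x) (a x) (b x - a x))) ⟩
      ∑ xs (λ x → w x * a x + w x * (b x - a x))                  ≈⟨ ∑-distrib-+ xs _ _ ⟩
      ∑ xs (λ x → w x * a x) + ∑ xs (λ x → w x * (b x - a x))     ∎)
      where
      as bs : List Carrier
      as = map a xs
      bs = map b xs

      -- At `bot` every `clamp` still has its initial value `a x`, and at `top` its final value
      -- `b x`. Starting the maximum from `bot` ensures `bot ≤ top`, also for an empty list.
      bot top : Carrier
      bot = min 0# as
      top = max bot bs

      G : Carrier → Carrier
      G t = ∑ xs (λ x → w x * clamp (a x) (b x) t)

      step : ∀ l r → l ≤ r → All (λ p → p ≤ l ⊎ r ≤ p) (as ++ bs) → G l ≤ G r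
      step l r l≤r outside = begin
        -- The increment of `G` from `l` to `r` is the value of the step function at `l`,
        -- nonnegative by `nonNeg`, times `r - l`.
        G l                                                 ≈⟨ +-identityʳ (G l) ⟨
        G l + 0#                                            ≤⟨ +-monoʳ-≤ (G l) (*-nonNeg (nonNeg l) (x≤y⇒0≤y-x l≤r)) ⟩
        G l + ∑ xs (λ x → w x * ind x) * (r - l)            ≈⟨ +-congˡ (*-distribʳ-∑ xs _ (r - l)) ⟨
        G l + ∑ xs (λ x → w x * ind x * (r - l))            ≈⟨ ∑-distrib-+ xs _ _ ⟨
        ∑ xs (λ x → w x * clamp (a x) (b x) l + w x * ind x * (r - l))
                                                            ≈⟨ ∑-cong-All (All.zipWith increment (All.map⁻ (All.++⁻ˡ as outside) , All.map⁻ (All.++⁻ʳ as outside))) ⟨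
        G r                                                 ∎
        where
        ind : A → Carrier
        ind x = 𝟙 (l ∈?[ a x , b x ⟩)

        increment : ∀ {x} → (a x ≤ l ⊎ r ≤ a x) × (b x ≤ l ⊎ r ≤ b x) →
          w x * clamp (a x) (b x) r ≈ w x * clamp (a x) (b x) l + w x * ind x * (r - l)
        increment {x} (a-outside , b-outside) = begin-equality
          w x * clamp (a x) (b x) r                             ≈⟨ *-congˡ (clamp-step (a≤b x) l≤r a-outside b-outside) ⟩
          w x * (clamp (a x) (b x) l + ind x * (r - l))         ≈⟨ distribˡ (w x) _ _ ⟩
          w x * clamp (a x) (b x) l + w x * (ind x * (r - l))   ≈⟨ +-congˡ (*-assoc (w x) (ind x) (r - l)) ⟨
          w x * clamp (a x) (b x) l + w x * ind x * (r - l)     ∎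

  -- Boxes in the plane and comparison of their areas.

  record Box : Set (c ⊔ ℓ₂) where
    field
      left right bottom top : Carrier
      left≤right            : left ≤ right
      bottom≤top            : bottom ≤ top

    width height area : Carrier
    width  = right - left
    height = top - bottom
    area   = width * height

  open Box

  Contains : Box → Carrier → Carrier → Set ℓ₂
  Contains B x y = x ∈[ left B , right B ⟩ × y ∈[ bottom B , top B ⟩

  contains? : ∀ B x y → Dec (Contains B x y)
  contains? B x y = (x ∈?[ left B , right B ⟩) ×-dec (y ∈?[ bottom B , top B ⟩)

  -- Written as a product, so that for a fixed `y` the vertical factor can be absorbed into the
  -- weight of a one-dimensional step function.
  indicator : Carrier → Carrier → Box → Carrier
  indicator x y B = 𝟙 (x ∈?[ left B , right B ⟩) * 𝟙 (y ∈?[ bottom B , top B ⟩)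

  indicator-in : ∀ {x y} B → Contains B x y → indicator x y B ≈ 1#
  indicator-in {x} {y} B (x∈ , y∈) = trans
    (*-cong (𝟙-true (x ∈?[ left B , right B ⟩) x∈) (𝟙-true (y ∈?[ bottom B , top B ⟩) y∈))
    (*-identityˡ 1#)

  indicator-out : ∀ {x y} B → ¬ Contains B x y → indicator x y B ≈ 0#
  indicator-out {x} {y} B ∉B with x ∈?[ left B , right B ⟩
  ... | no x∉  = trans (*-congʳ (𝟙-false (x ∈?[ left B , right B ⟩) x∉)) (zeroˡ _)
  ... | yes x∈ = trans (*-congˡ (𝟙-false (y ∈?[ bottom B , top B ⟩) λ y∈ → ∉B (x∈ , y∈))) (zeroʳ _)

  0≤indicator : ∀ x y B → 0# ≤ indicator x y B
  0≤indicator x y B with contains? B x y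
  ... | yes ∈B = ≤-trans 0≤1 (reflexive (sym (indicator-in B ∈B)))
  ... | no ∉B  = reflexive (sym (indicator-out B ∉B))

  -- Fubini: the one-dimensional case is applied to each horizontal line, and then to
  -- the weights wₓ · width.

  area-nonNeg : ∀ {i} {A : Set i} (xs : List A) (w : A → Carrier) (box : A → Box) →
    (∀ x y → 0# ≤ ∑ xs (λ z → w z * indicator x y (box z))) →
    0# ≤ ∑ xs (λ z → w z * area (box z))
  area-nonNeg xs w box nonNeg = ≤-trans
    (length-nonNeg xs (λ z → w z * width (box z)) (bottom ∘ box) (top ∘ box) (bottom≤top ∘ box) λ y →
      ≤-trans
        (length-nonNeg xs (λ z → w z * vertical y z) (left ∘ box) (right ∘ box) (left≤right ∘ box) λ x →
          ≤-trans (nonNeg x y) (reflexive (∑-cong xs λ z →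
            trans (sym (*-assoc (w z) _ _)) (*-xy∙z≈xz∙y (w z) _ _))))
        (reflexive (∑-cong xs λ z → *-xy∙z≈xz∙y (w z) (vertical y z) (width (box z)))))
    (reflexive (∑-cong xs λ z → *-assoc (w z) (width (box z)) (height (box z))))
    where
    vertical : Carrier → _ → Carrier
    vertical y z = 𝟙 (y ∈?[ bottom (box z) , top (box z) ⟩)

  -- Joining `bs` with weight `1#` and `as` with weight `- 1#` into one list turns the comparison
  -- into the nonnegativity statement `area-nonNeg`.
  area-mono : ∀ as bs →
    (∀ x y → ∑ as (indicator x y) ≤ ∑ bs (indicator x y)) → ∑ as area ≤ ∑ bs area
  area-mono as bs le = 0≤y-x⇒x≤y (≤-trans
    (area-nonNeg signed proj₁ proj₂ λ x y →
      ≤-trans (x≤y⇒0≤y-x (le x y)) (reflexive (sym (∑-signed (indicator x y)))))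
    (reflexive (∑-signed area)))
    where
    signed : List (Carrier × Box)
    signed = map (1# ,_) bs ++ map (- 1# ,_) as

    weighted : (Box → Carrier) → Carrier × Box → Carrier
    weighted f (w , B) = w * f B

    ∑-weighted : ∀ k xs (f : Box → Carrier) →
      ∑ (map (k ,_) xs) (weighted f) ≈ k * ∑ xs f
    ∑-weighted k xs f = begin-equality
      ∑ (map (k ,_) xs) (weighted f)  ≈⟨ ∑-map (k ,_) xs _ ⟩
      ∑ xs (λ B → k * f B)                     ≈⟨ ∑-cong xs (λ B → *-comm k (f B)) ⟩
      ∑ xs (λ B → f B * k)                     ≈⟨ *-distribʳ-∑ xs f k ⟩
      ∑ xs f * k                               ≈⟨ *-comm (∑ xs f) k ⟩
      k * ∑ xs f                               ∎

    ∑-signed : ∀ f → ∑ signed (weighted f) ≈ ∑ bs f - ∑ as f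
    ∑-signed f = begin-equality
      ∑ signed (weighted f)       ≈⟨ ∑-++ (map (1# ,_) bs) (map (- 1# ,_) as) (weighted f) ⟩
      _ + _                                ≈⟨ +-cong (∑-weighted 1# bs f) (∑-weighted (- 1#) as f) ⟩
      1# * ∑ bs f + - 1# * ∑ as f          ≈⟨ +-cong (*-identityˡ (∑ bs f)) (-1*x≈-x (∑ as f)) ⟩
      ∑ bs f - ∑ as f                      ∎

  -- Covering and packing inequalities for boxes.

  ContainsClosed : Box → Carrier → Carrier → Set ℓ₂
  ContainsClosed B x y = (left B ≤ x × x ≤ right B) × (bottom B ≤ y × y ≤ top B)

  -- The shift from `t` to `t′` did not cross `a`, which keeps the left inequality; being strict, it
  -- makes the right inequality strict at `t`.
  right-neighbour∈ : ∀ {t t′ a b} → t ≺ t′ → (a ≤ t′ → a ≤ t) → a ≤ t′ → t′ ≤ b → t ∈[ a , b ⟩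
  right-neighbour∈ t<t′ free a≤t′ t′≤b = free a≤t′ , <⇒≱ (<-≤-trans t<t′ t′≤b)

  -- A point is moved slightly up and to the right, so that a closed box containing
  -- the moved point contains the original one in the half-open sense.

  area-cover : ∀ R bs →
    (∀ x y → ContainsClosed R x y → Any (λ B → ContainsClosed B x y) bs) →
    area R ≤ ∑ bs area
  area-cover R bs cover = ≤-trans (reflexive (sym (+-identityʳ (area R)))) (area-mono (R ∷ []) bs pointwise)
    where
    covered : ∀ x y → Contains R x y → Any (λ B → Contains B x y) bs
    -- The thresholds `right R` and `top R` keep the moved point in `R`; the left and bottom edges
    -- of `bs` ensure that no box is entered by the move.
    covered x y ((l≤x , r≰x) , (b≤y , t≰y)) with
        right-neighbour x (right R ∷ map left bs) | right-neighbour y (top R ∷ map bottom bs)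
    ... | x′ , x<x′ , free-r ∷ free-x | y′ , y<y′ , free-t ∷ free-y =
      Any.map (λ (((fx , fy) , ((l , r) , (b , t)))) → right-neighbour∈ x<x′ fx l r , right-neighbour∈ y<y′ fy b t)
        (zip-Any (All.zip (All.map⁻ free-x , All.map⁻ free-y))
          (cover x′ y′ ( (≤-trans l≤x (proj₁ x<x′) , ≰⇒≥ (r≰x ∘ free-r))
                       , (≤-trans b≤y (proj₁ y<y′) , ≰⇒≥ (t≰y ∘ free-t)))))
      where
      zip-Any : ∀ {p q} {P : Box → Set p} {Q : Box → Set q} {xs} →
                All P xs → Any Q xs → Any (λ B → P B × Q B) xs
      zip-Any (p ∷ _)  (here q)   = here (p , q)
      zip-Any (_ ∷ ps) (there qs) = there (zip-Any ps qs)

    pointwise : ∀ x y → indicator x y R + 0# ≤ ∑ bs (indicator x y)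
    pointwise x y with contains? R x y
    ... | no ∉R = begin
      indicator x y R + 0#    ≈⟨ +-identityʳ _ ⟩
      indicator x y R         ≈⟨ indicator-out R ∉R ⟩
      0#                      ≤⟨ ∑-nonNeg bs (0≤indicator x y) ⟩
      ∑ bs (indicator x y)    ∎
    ... | yes ∈R = begin
      indicator x y R + 0#    ≈⟨ +-identityʳ _ ⟩
      indicator x y R         ≈⟨ indicator-in R ∈R ⟩
      1#                      ≤⟨ ∑-≥1 (0≤indicator x y) (λ {B} → indicator-in B) (covered x y ∈R) ⟩
      ∑ bs (indicator x y)    ∎

  Disjoint : Box → Box → Set (c ⊔ ℓ₂)
  Disjoint B C = ∀ x y → Contains B x y → ¬ Contains C x y

  -- At each point at most one box of `bs` has indicator `1#`, and then so does `R`; the areas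
  -- follow by `area-mono`.
  area-pack : ∀ R bs → AllPairs Disjoint bs →
    All (λ B → ∀ x y → Contains B x y → Contains R x y) bs →
    ∑ bs area ≤ area R
  area-pack R bs disjoint inside = ≤-trans
    (area-mono bs (R ∷ []) λ x y → ≤-trans (pointwise x y disjoint inside) (reflexive (sym (+-identityʳ _))))
    (reflexive (+-identityʳ (area R)))
    where
    pointwise : ∀ x y {bs} → AllPairs Disjoint bs →
      All (λ B → ∀ x y → Contains B x y → Contains R x y) bs →
      ∑ bs (indicator x y) ≤ indicator x y R
    pointwise x y [] [] = 0≤indicator x y R
    pointwise x y {B ∷ bs} (B# ∷ disjoint) (B⊆R ∷ inside) with contains? B x y
    ... | yes ∈B = begin
      indicator x y B + ∑ bs (indicator x y)  ≈⟨ +-cong (indicator-in B ∈B) (∑-zero (All.map (λ {C} B#C → indicator-out C (B#C x y ∈B)) B#)) ⟩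
      1# + 0#                                 ≈⟨ +-identityʳ 1# ⟩
      1#                                      ≈⟨ indicator-in R (B⊆R x y ∈B) ⟨
      indicator x y R                         ∎
    ... | no ∉B = begin
      indicator x y B + ∑ bs (indicator x y)  ≈⟨ +-congʳ (indicator-out B ∉B) ⟩
      0# + ∑ bs (indicator x y)               ≈⟨ +-identityˡ _ ⟩
      ∑ bs (indicator x y)                    ≤⟨ pointwise x y disjoint inside ⟩
      indicator x y R                         ∎

-- Squares of an instance as boxes in the strip.

module Packing {c ℓ₁ ℓ₂} (F : OrderedField c ℓ₁ ℓ₂) {n : ℕ}
               (I : SquarePacking.Instance F n) where

  open OrderedFieldProperties F
  open Area F
  open SquarePacking F
  open Instance I

  squareBox : Fin n → Point → Box
  squareBox i (x , y) = record
    { left = x ; right = x + side i ; bottom = y ; top = y + side i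
    ; left≤right = x≤x+side x ; bottom≤top = x≤x+side y }
    where
    x≤x+side : ∀ x → x ≤ x + side i
    x≤x+side x = ≤-trans (reflexive (sym (+-identityʳ x))) (+-monoʳ-≤ x (proj₁ (side>0 i)))

  area-squareBox : ∀ i p → Box.area (squareBox i p) ≈ side i * side i
  area-squareBox i (x , y) = *-cong (xyx⁻¹≈y x (side i)) (xyx⁻¹≈y y (side i))

  0≤side² : ∀ i → 0# ≤ side i * side i
  0≤side² i = *-nonNeg (proj₁ (side>0 i)) (proj₁ (side>0 i))

  totalArea : Carrier
  totalArea = ∑ (allFin n) (λ i → side i * side i)

  0<W : Fin n → 0# ≺ W
  0<W i = <-≤-trans (side>0 i) (side≤W i)

  module _ (W≥0 : 0# ≤ W) {H : Carrier} (H≥0 : 0# ≤ H) where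

    substripBox : Box
    substripBox = record
      { left = 0# ; right = W ; bottom = 0# ; top = H ; left≤right = W≥0 ; bottom≤top = H≥0 }

    area-substripBox : Box.area substripBox ≈ W * H
    area-substripBox = *-cong x-0≈x x-0≈x
      where
      x-0≈x : ∀ {x} → x - 0# ≈ x
      x-0≈x {x} = trans (sym (+-identityʳ (x - 0#))) ([y-x]+x≈y 0# x)

  square? : ∀ p s q → Dec (Square p s q)
  square? (x , y) s (u , v) =
    ((x ≤? u) ×-dec (u ≤? x + s)) ×-dec ((y ≤? v) ×-dec (v ≤? y + s))

  -- A common point of the half-open boxes is moved right and up without reaching a right or top
  -- edge; the strict move also clears the left and bottom edges. Hence disjoint interiors make the
  -- half-open boxes disjoint.
  interior-overlap : ∀ {i j p q x y} → Contains (squareBox i p) x y → Contains (squareBox j q) x y →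
    ∃[ z ] (Interior p (side i) z × Interior q (side j) z)
  interior-overlap {i} {j} {p₁ , p₂} {q₁ , q₂} {x} {y}
    ((a≤x , x<b) , (c≤y , y<d)) ((a′≤x , x<b′) , (c′≤y , y<d′)) with
      right-neighbour x (p₁ + side i ∷ q₁ + side j ∷ []) | right-neighbour y (p₂ + side i ∷ q₂ + side j ∷ [])
  ... | x′ , x<x′ , b-free ∷ b′-free ∷ [] | y′ , y<y′ , d-free ∷ d′-free ∷ [] =
      (x′ , y′)
    , ((≤-<-trans a≤x x<x′ , ≰⇒> (x<b ∘ b-free)) , (≤-<-trans c≤y y<y′ , ≰⇒> (y<d ∘ d-free)))
    , ((≤-<-trans a′≤x x<x′ , ≰⇒> (x<b′ ∘ b′-free)) , (≤-<-trans c′≤y y<y′ , ≰⇒> (y<d′ ∘ d′-free)))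

  -- Area bounds for packings and coverings.

  module _ {pos : Placement I} {h : Carrier} (packing : IsPacking I pos) (height : IsHeight I pos h) where

    -- Containment in the strip is tested at two opposite corners; the bound by `h` comes from the
    -- maximality in `IsHeight`.
    square⊆substrip : ∀ i → (0# ≤ proj₁ (pos i) × proj₁ (pos i) + side i ≤ W)
                          × (0# ≤ proj₂ (pos i) × proj₂ (pos i) + side i ≤ h)
    square⊆substrip i =
        (proj₁ (proj₁ lower-left) , proj₂ (proj₁ upper-right))
      , (proj₂ lower-left , proj₂ height _ (i , refl))
      where
      open Box (squareBox i (pos i)) using (left≤right; bottom≤top)

      lower-left : Strip W (pos i)
      lower-left = proj₁ packing i ((≤-refl , left≤right) , (≤-refl , bottom≤top))

      upper-right : Strip W (proj₁ (pos i) + side i , proj₂ (pos i) + side i)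
      upper-right = proj₁ packing i ((left≤right , ≤-refl) , (bottom≤top , ≤-refl))

    side≤height : ∀ i → side i ≤ h
    side≤height i with square⊆substrip i
    ... | _ , (0≤y , top≤h) = begin
      side i                     ≈⟨ +-identityˡ (side i) ⟨
      0# + side i                ≤⟨ +-mono-≤ 0≤y ≤-refl ⟩
      proj₂ (pos i) + side i     ≤⟨ top≤h ⟩
      h                          ∎

    totalArea≤ : 0# ≤ W → 0# ≤ h → totalArea ≤ W * h
    totalArea≤ W≥0 h≥0 = begin
      totalArea                       ≈⟨ ∑-cong (allFin n) (λ i → area-squareBox i (pos i)) ⟨
      ∑ (allFin n) (Box.area ∘ box)   ≈⟨ ∑-map box (allFin n) Box.area ⟨
      ∑ (map box (allFin n)) Box.area ≤⟨ area-pack (substripBox W≥0 h≥0) (map box (allFin n))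
                                           (AllPairs.map⁺ (AllPairs.tabulate⁺ disjoint))
                                           (All.map⁺ (All.universal inside (allFin n))) ⟩
      Box.area (substripBox W≥0 h≥0)  ≈⟨ area-substripBox W≥0 h≥0 ⟩
      W * h                           ∎
      where
      box : Fin n → Box
      box i = squareBox i (pos i)

      disjoint : ∀ {i j} → i ≢ j → Disjoint (box i) (box j)
      disjoint {i} {j} i≢j x y ∈i ∈j with interior-overlap ∈i ∈j
      ... | z , z∈i , z∈j = proj₂ packing i j i≢j (z∈i , z∈j)

      inside : ∀ i x y → Contains (box i) x y → Contains (substripBox W≥0 h≥0) x y
      inside i x y ((l≤x , r≰x) , (b≤y , t≰y)) with square⊆substrip i
      ... | (0≤l , r≤W) , (0≤b , t≤h) =
          (≤-trans 0≤l l≤x , r≰x ∘ ≤-trans r≤W)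
        , (≤-trans 0≤b b≤y , t≰y ∘ ≤-trans t≤h)

  -- Each square is counted once where it is placed and at most `f` times as a copy, hence the
  -- factor `ℕ.suc f`. Overlaps and parts outside the substrip only enlarge the right-hand side.
  covered-area : ∀ {pos : Placement I} {H f} → CoverableBy I f (Unoccupied I pos H) →
    0# ≤ W → 0# ≤ H → W * H ≤ fromℕ (ℕ.suc f) * totalArea
  covered-area {pos} {H} {f} (copies , copies≤f , cover) W≥0 H≥0 = begin
    W * H                                             ≈⟨ area-substripBox W≥0 H≥0 ⟨
    Box.area (substripBox W≥0 H≥0)                    ≤⟨ area-cover (substripBox W≥0 H≥0) boxes covered ⟩
    ∑ boxes Box.area                                  ≈⟨ ∑-concatMap translates (allFin n) Box.area ⟩
    ∑ (allFin n) (λ i → ∑ (translates i) Box.area)    ≤⟨ ∑-mono (allFin n) translates-area ⟩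
    ∑ (allFin n) (λ i → fromℕ (ℕ.suc f) * (side i * side i))
                                                      ≈⟨ ∑-cong (allFin n) (λ i → *-comm (fromℕ (ℕ.suc f)) _) ⟩
    ∑ (allFin n) (λ i → side i * side i * fromℕ (ℕ.suc f))
                                                      ≈⟨ *-distribʳ-∑ (allFin n) _ (fromℕ (ℕ.suc f)) ⟩
    totalArea * fromℕ (ℕ.suc f)                       ≈⟨ *-comm totalArea _ ⟩
    fromℕ (ℕ.suc f) * totalArea                       ∎
    where
    translates : Fin n → List Box
    translates i = map (squareBox i) (pos i ∷ copies i)

    boxes : List Box
    boxes = concatMap translates (allFin n)

    translates-area : ∀ i → ∑ (translates i) Box.area ≤ fromℕ (ℕ.suc f) * (side i * side i)
    translates-area i = ≤-trans
      (reflexive (∑-map (squareBox i) (pos i ∷ copies i) Box.area))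
      (∑-≤-length (pos i ∷ copies i) (ℕ.s≤s (copies≤f i)) (0≤side² i)
        (λ p → reflexive (area-squareBox i p)))

    among-translates : ∀ {x y} i → Any (λ p → Square p (side i) (x , y)) (pos i ∷ copies i) →
      Any (λ B → ContainsClosed B x y) boxes
    among-translates {x} {y} i hit = Any.concatMap⁺ translates
      (Any.map (λ { ≡.refl → Any.map⁺ hit }) (∈-allFin i))

    covered : ∀ x y → ContainsClosed (substripBox W≥0 H≥0) x y → Any (λ B → ContainsClosed B x y) boxes
    -- The order is decidable and there are finitely many squares, so a search decides whether the
    -- point is occupied; if not, `cover` supplies a copy.
    covered x y ∈strip with any? (λ i → square? (pos i) (side i) (x , y))
    ... | yes (i , ∈square) = among-translates i (here ∈square)
    ... | no unoccupied with cover (∈strip , unoccupied)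
    ...   | i , ∈copy = among-translates i (there ∈copy)

  -- The largest square fits below `hOPT`, which gives both `hMax ≤ hOPT` and the positivity of
  -- `hOPT` needed for the division.
  bottomLeft-bound : ∀ {hOPT hMax hBL g f} {pos : Placement I} →
    IsOptimalHeight I hOPT → IsLargestSide I hMax → 0# ≤ g →
    CoverableBy I f (Unoccupied I pos (hBL - g * hMax)) →
    hBL / hOPT ≤ fromℕ f + g + 1#
  bottomLeft-bound {hOPT} {hMax} {hBL} {g} {f}
    ((_ , packing , height) , _) ((largest , hMax≈side) , _) 0≤g cover =
    x≤yk⇒x/k≤y 0<hOPT (begin
      hBL                                    ≤⟨ x-y≤z⇒x≤z+y H≤ ⟩
      (1# + fromℕ f) * hOPT + g * hMax       ≤⟨ +-monoʳ-≤ _ (*-monoˡ-≤ 0≤g hMax≤hOPT) ⟩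
      (1# + fromℕ f) * hOPT + g * hOPT       ≈⟨ distribʳ hOPT (1# + fromℕ f) g ⟨
      (1# + fromℕ f + g) * hOPT              ≈⟨ *-congʳ (trans (+-assoc 1# (fromℕ f) g) (+-comm 1# (fromℕ f + g))) ⟩
      (fromℕ f + g + 1#) * hOPT              ∎)
    where
    H : Carrier
    H = hBL - g * hMax

    hMax≤hOPT : hMax ≤ hOPT
    hMax≤hOPT = ≤-trans (reflexive hMax≈side) (side≤height packing height largest)

    0<hOPT : 0# ≺ hOPT
    0<hOPT = <-≤-trans (side>0 largest) (side≤height packing height largest)

    W≥0 : 0# ≤ W
    W≥0 = proj₁ (0<W largest)

    H≤ : H ≤ (1# + fromℕ f) * hOPT
    H≤ with total 0# H
    -- For large `g` the height `H` may be negative and then spans no box, but the bound is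
    -- immediate as its right-hand side is nonnegative.
    ... | inj₂ H≤0 = ≤-trans H≤0 (*-nonNeg (0≤fromℕ (ℕ.suc f)) (proj₁ 0<hOPT))
    -- Both area inequalities are chained through `totalArea`, and the common positive factor `W` is
    -- cancelled.
    ... | inj₁ 0≤H = *-cancelʳ-≤ (0<W largest) (begin
      H * W                              ≈⟨ *-comm H W ⟩
      W * H                              ≤⟨ covered-area cover W≥0 0≤H ⟩
      (1# + fromℕ f) * totalArea         ≤⟨ *-monoˡ-≤ (0≤fromℕ (ℕ.suc f)) (totalArea≤ packing height W≥0 (proj₁ 0<hOPT)) ⟩
      (1# + fromℕ f) * (W * hOPT)        ≈⟨ *-congˡ (*-comm W hOPT) ⟩
      (1# + fromℕ f) * (hOPT * W)        ≈⟨ *-assoc _ hOPT W ⟨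
      (1# + fromℕ f) * hOPT * W          ∎)

theorem14 : ∀ {c ℓ₁ ℓ₂} (F : OrderedField c ℓ₁ ℓ₂) →
    let open OrderedField F
        open SquarePacking F
    in ∀ {n : ℕ} (I : Instance n) →
       (hWorst hOPT hMax : Carrier) →
       IsWorstBottomLeftHeight I hWorst →
       IsOptimalHeight I hOPT →
       IsLargestSide I hMax →
       (σ : Permutation′ n) (pos : Placement I) (hBL : Carrier) →
       IsBottomLeft I σ pos →
       IsHeight I pos hBL →
       hBL ≈ hWorst →
       (g : Carrier) → 0# ≤ g →
       (f : ℕ) → CoverableBy I f (Unoccupied I pos (hBL - g * hMax)) →
       hWorst / hOPT ≤ fromℕ f + g + 1#
theorem14 F I hWorst hOPT hMax _ optimal largest σ pos hBL _ _ hBL≈hWorst g 0≤g f cover = begin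
    hWorst / hOPT       ≈⟨ *-congʳ hBL≈hWorst ⟨
    hBL / hOPT          ≤⟨ Packing.bottomLeft-bound F I optimal largest 0≤g cover ⟩
    fromℕ f + g + 1#    ∎
  where open OrderedFieldProperties F
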